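{- For every derivation in $\mathsf{SKSgq}$ with premise $Q$ and conclusion $P$ there exists a derivation in $\mathsf{GS1}+\mathsf{Cut}$ with premise $\vdash\underline{Q}_{G}$ and conclusion $\vdash\underline{P}_{G}$.
   Context: First-order terms are as usual; atoms are expressions $p(t_1,\dots,t_n)$ with $p$ a predicate symbol of arity $n$, and the negation of an atom is again an atom. Structures: $S ::= \mathsf f \mid \mathsf t \mid a \mid [S,\dots,S] \mid (S,\dots,S) \mid \bar S \mid \exists x S \mid \forall x S$ (non-empty lists), with $[\cdot]$ disjunction, $(\cdot)$ conjunction, $\bar S$ negation. A context $S\{\ \}$ is a structure with one occurrence of a hole, not in the scope of a negation; $S\{R\}$ fills the hole with $R$ (quantifiers of $S$ may capture variables of $R$); $S[R,T]$ abbreviates $S\{[R,T]\}$, $S(R,T)$ abbreviates $S\{(R,T)\}$. $R[x/t]$ denotes substitution of the term $t$ for $x$ in $R$, where $t$ must be free for $x$ in $R$. Equivalent structures are not distinguished; equivalence is the smallest equivalence relation induced by: $[\vec R,[\vec T],\vec U]=[\vec R,\vec T,\vec U]$, $(\vec R,(\vec T),\vec U)=(\vec R,\vec T,\vec U)$ ($\vec T$ non-empty); $[R,T]=[T,R]$, $(R,T)=(T,R)$; $(\mathsf f,\mathsf f)=\mathsf f$, $[\mathsf f,R]=R$, $[\mathsf t,\mathsf t]=\mathsf t$, $(\mathsf t,R)=R$; $\bar{\mathsf f}=\mathsf t$, $\bar{\mathsf t}=\mathsf f$, $\overline{[R,T]}=(\bar R,\bar T)$, $\overline{(R,T)}=[\bar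 R,\bar T]$, $\bar{\bar R}=R$, $\overline{\exists xR}=\forall x\bar R$, $\overline{\forall xR}=\exists x\bar R$; $\forall xR=\forall yR[x/y]$ and $\exists xR=\exists yR[x/y]$ if $y$ is not free in $R$; $\forall yR=\exists yR=R$ if $y$ is not free in $R$; and closure: if $R=T$ then $S\{R\}=S\{T\}$ and $\bar R=\bar T$. A derivation in a system (set of inference rules) is a finite sequence of rule instances, read top-down, the conclusion of each being the premise of the next; it may consist of a single structure. Its premise is the topmost structure, its conclusion the bottommost. System $\mathsf{SKSgq}$ has the rules (written $\frac{\text{premise}}{\text{conclusion}}$): $i{\downarrow}:\frac{S\{\mathsf t\}}{S[R,\bar R]}$, $i{\uparrow}:\frac{S(R,\bar R)}{S\{\mathsf f\}}$, $s:\frac{S([R,U],T)}{S[(R,T),U]}$, $w{\downarrow}:\frac{S\{\mathsf f\}}{S\{R\}}$, $w{\uparrow}:\frac{S\{R\}}{S\{\mathsf t\}}$, $c{\downarrow}:\frac{S[R,R]}{S\{R\}}$, $c{\uparrow}:\frac{S\{R\}}{S(R,R)}$, $u{\downarrow}:\frac{S\{\forall x[R,T]\}}{S[\forall xR,\exists xT]}$, $u{\uparrow}:\frac{S(\exists xR,\forall xT)}{S\{\exists x(R,T)\}}$, $n{\downarrow}:\frac{S\{R[x/t]\}}{S\{\exists xR\}}$, $n{\uparrow}:\frac{S\{\forall xR\}}{S\{R[x/t]\}}$. Sequent system: formulae are built from atoms (closed under negation) and constants $\top,\bot$ with $\wedge,\vee,\exists,\forall$; negation occurs only on atoms and $\bar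 A$ is the De Morgan dual of $A$. Sequents are finite multisets of formulae. $\mathsf{GS1}+\mathsf{Cut}$ has the rules: $\top$: infer $\vdash\top$; $\mathsf{Ax}$: infer $\vdash A,\bar A$; $\mathsf R\wedge$: from $\vdash\Phi,A$ and $\vdash\Psi,B$ infer $\vdash\Phi,\Psi,A\wedge B$; $\mathsf R\vee$: from $\vdash\Phi,A,B$ infer $\vdash\Phi,A\vee B$; $\mathsf{RC}$: from $\vdash\Phi,A,A$ infer $\vdash\Phi,A$; $\mathsf{RW}$: from $\vdash\Phi$ infer $\vdash\Phi,A$; $\mathsf R\exists$: from $\vdash\Phi,A[x/t]$ infer $\vdash\Phi,\exists xA$; $\mathsf R\forall$: from $\vdash\Phi,A[x/y]$ infer $\vdash\Phi,\forall xA$, provided $y$ is not free in the conclusion; $\mathsf{Cut}$: from $\vdash\Phi,A$ and $\vdash\Psi,\bar A$ infer $\vdash\Phi,\Psi$. Derivations are trees built by these rules; the premises are the open leaves (not closed by an axiom). For the translation, structures are assumed to contain negation only on atoms and only conjunctions and disjunctions of exactly two structures (every structure is equivalent to such a one). Translation: $\underline a_G=a$, $\underline{\mathsf t}_G=\top$, $\underline{\mathsf f}_G=\bot$, $\underline{[R,T]}_G=\underline R_G\vee\underline T_G$, $\underline{(R,T)}_G=\underline R_G\wedge\underline T_G$, $\underline{\exists xS}_G=\exists x\underline S_G$, $\underline{\forall xS}_G=\forall x\underline S_G$. -}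

module Defs where

open import Data.Bool using (if_then_else_)
open import Data.List using (List; []; _∷_; _++_)
open import Data.List.NonEmpty using (List⁺; _∷_; _++⁺_; _⁺++_; toList)
open import Data.List.Relation.Binary.Permutation.Propositional using (_↭_)
open import Data.List.Relation.Unary.All using (All)
open import Data.List.Relation.Unary.Any using (Any)
open import Data.Nat using (ℕ; _≟_)
open import Data.Vec using (Vec; []; _∷_)
import Data.Vec.Relation.Unary.Any as Vec
open import Relation.Binary.Construct.Closure.ReflexiveTransitive using (Star)
open import Relation.Binary.Construct.Union using (_∪_)
open import Relation.Binary.PropositionalEquality using (_≢_)
open import Relation.Nullary using (¬_; does)

record Signature : Set₁ where
  field
    Func     : Set
    funArity : Func → ℕ
    Pred     : Set
    preArity : Pred → ℕ

Var : Set
Var = ℕ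

module Calculi (𝓛 : Signature) where

  open Signature 𝓛

  ----------------------------------------------------------------------
  -- Terms and atoms

  data Term : Set where
    var : Var → Term
    fun : (g : Func) → Vec Term (funArity g) → Term

  data _∈ᵗ_ (x : Var) : Term → Set where
    here : x ∈ᵗ var x
    args : ∀ {g ts} → Vec.Any (x ∈ᵗ_) ts → x ∈ᵗ fun g ts

  mutual
    _[_/_]ᵗ : Term → Var → Term → Term
    var y    [ x / t ]ᵗ = if does (x ≟ y) then t else var y
    fun g ts [ x / t ]ᵗ = fun g (ts [ x / t ]ᵗˢ)

    _[_/_]ᵗˢ : ∀ {n} → Vec Term n → Var → Term → Vec Term n
    []       [ x / t ]ᵗˢ = []
    (u ∷ us) [ x / t ]ᵗˢ = u [ x / t ]ᵗ ∷ us [ x / t ]ᵗˢ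

  -- The negation of an atom is again an atom, so atoms carry a polarity.
  data Atom : Set where
    pos neg : (p : Pred) → Vec Term (preArity p) → Atom

  dualᵃ : Atom → Atom
  dualᵃ (pos p ts) = neg p ts
  dualᵃ (neg p ts) = pos p ts

  data _∈ᵃ_ (x : Var) : Atom → Set where
    pos : ∀ {p ts} → Vec.Any (x ∈ᵗ_) ts → x ∈ᵃ pos p ts
    neg : ∀ {p ts} → Vec.Any (x ∈ᵗ_) ts → x ∈ᵃ neg p ts

  _[_/_]ᵃ : Atom → Var → Term → Atom
  pos p ts [ x / t ]ᵃ = pos p (ts [ x / t ]ᵗˢ)
  neg p ts [ x / t ]ᵃ = neg p (ts [ x / t ]ᵗˢ)

  ----------------------------------------------------------------------
  -- Structures

  infix 8 ∼_

  data Structure : Set where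
    𝖿 𝗍   : Structure
    atom  : Atom → Structure
    ⋁ ⋀   : List⁺ Structure → Structure
    ∼_    : Structure → Structure
    ∃ˢ ∀ˢ : Var → Structure → Structure

  pattern [_,_] R T = ⋁ (R ∷ T ∷ [])
  pattern ⦅_,_⦆ R T = ⋀ (R ∷ T ∷ [])

  -- x ∈ˢ R : the variable x occurs free in R.
  data _∈ˢ_ (x : Var) : Structure → Set where
    atom : ∀ {a} → x ∈ᵃ a → x ∈ˢ atom a
    ⋁    : ∀ {Rs} → Any (x ∈ˢ_) (toList Rs) → x ∈ˢ ⋁ Rs
    ⋀    : ∀ {Rs} → Any (x ∈ˢ_) (toList Rs) → x ∈ˢ ⋀ Rs
    ∼_   : ∀ {R} → x ∈ˢ R → x ∈ˢ (∼ R)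
    ∃ˢ   : ∀ {y R} → x ≢ y → x ∈ˢ R → x ∈ˢ ∃ˢ y R
    ∀ˢ   : ∀ {y R} → x ≢ y → x ∈ˢ R → x ∈ˢ ∀ˢ y R

  -- Replacement of the free occurrences of x by t, without renaming; it is
  -- only ever used together with FreeForˢ.
  mutual
    _[_/_]ˢ : Structure → Var → Term → Structure
    𝖿            [ x / t ]ˢ = 𝖿
    𝗍            [ x / t ]ˢ = 𝗍
    atom a       [ x / t ]ˢ = atom (a [ x / t ]ᵃ)
    ⋁ (R ∷ Rs)   [ x / t ]ˢ = ⋁ (R [ x / t ]ˢ ∷ Rs [ x / t ]ˢˢ)
    ⋀ (R ∷ Rs)   [ x / t ]ˢ = ⋀ (R [ x / t ]ˢ ∷ Rs [ x / t ]ˢˢ)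
    (∼ R)        [ x / t ]ˢ = ∼ (R [ x / t ]ˢ)
    ∃ˢ y R       [ x / t ]ˢ = ∃ˢ y (if does (x ≟ y) then R else R [ x / t ]ˢ)
    ∀ˢ y R       [ x / t ]ˢ = ∀ˢ y (if does (x ≟ y) then R else R [ x / t ]ˢ)

    _[_/_]ˢˢ : List Structure → Var → Term → List Structure
    []       [ x / t ]ˢˢ = []
    (R ∷ Rs) [ x / t ]ˢˢ = R [ x / t ]ˢ ∷ Rs [ x / t ]ˢˢ

  -- t is free for x in R: no free occurrence of x in R lies in the scope of
  -- a quantifier that binds a variable of t.
  data FreeForˢ (t : Term) (x : Var) : Structure → Set where
    𝖿    : FreeForˢ t x 𝖿
    𝗍    : FreeForˢ t x 𝗍
    atom : ∀ {a} → FreeForˢ t x (atom a)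
    ⋁    : ∀ {Rs} → All (FreeForˢ t x) (toList Rs) → FreeForˢ t x (⋁ Rs)
    ⋀    : ∀ {Rs} → All (FreeForˢ t x) (toList Rs) → FreeForˢ t x (⋀ Rs)
    ∼_   : ∀ {R} → FreeForˢ t x R → FreeForˢ t x (∼ R)
    ∃ˢ-∉ : ∀ {y R} → ¬ (x ∈ˢ ∃ˢ y R) → FreeForˢ t x (∃ˢ y R)
    ∃ˢ   : ∀ {y R} → ¬ (y ∈ᵗ t) → FreeForˢ t x R → FreeForˢ t x (∃ˢ y R)
    ∀ˢ-∉ : ∀ {y R} → ¬ (x ∈ˢ ∀ˢ y R) → FreeForˢ t x (∀ˢ y R)
    ∀ˢ   : ∀ {y R} → ¬ (y ∈ᵗ t) → FreeForˢ t x R → FreeForˢ t x (∀ˢ y R)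

  data Context : Set where
    ∙     : Context
    ⋁ ⋀   : List Structure → Context → List Structure → Context
    ∃ˢ ∀ˢ : Var → Context → Context

  -- Filling the hole may capture variables.
  _⟪_⟫ : Context → Structure → Structure
  ∙         ⟪ R ⟫ = R
  ⋁ Ts S Us ⟪ R ⟫ = ⋁ (Ts ++⁺ (S ⟪ R ⟫ ∷ Us))
  ⋀ Ts S Us ⟪ R ⟫ = ⋀ (Ts ++⁺ (S ⟪ R ⟫ ∷ Us))
  ∃ˢ x S    ⟪ R ⟫ = ∃ˢ x (S ⟪ R ⟫)
  ∀ˢ x S    ⟪ R ⟫ = ∀ˢ x (S ⟪ R ⟫)

  infix 4 _≈_

  data _≈_ : Structure → Structure → Set where
    ≈-refl  : ∀ {R} → R ≈ R
    ≈-sym   : ∀ {R T} → R ≈ T → T ≈ R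
    ≈-trans : ∀ {R T U} → R ≈ T → T ≈ U → R ≈ U

    ⋁-assoc : ∀ Rs Ts Us → ⋁ (Rs ++⁺ (⋁ Ts ∷ Us)) ≈ ⋁ (Rs ++⁺ (Ts ⁺++ Us))
    ⋀-assoc : ∀ Rs Ts Us → ⋀ (Rs ++⁺ (⋀ Ts ∷ Us)) ≈ ⋀ (Rs ++⁺ (Ts ⁺++ Us))

    ⋁-comm  : ∀ R T → [ R , T ] ≈ [ T , R ]
    ⋀-comm  : ∀ R T → ⦅ R , T ⦆ ≈ ⦅ T , R ⦆

    ⋀-𝖿     : ⦅ 𝖿 , 𝖿 ⦆ ≈ 𝖿
    ⋁-unit  : ∀ R → [ 𝖿 , R ] ≈ R
    ⋁-𝗍     : [ 𝗍 , 𝗍 ] ≈ 𝗍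
    ⋀-unit  : ∀ R → ⦅ 𝗍 , R ⦆ ≈ R

    -- Identifies the negation of the structure a with the atom ā.
    ∼-atom  : ∀ a → ∼ atom a ≈ atom (dualᵃ a)
    ∼-𝖿     : ∼ 𝖿 ≈ 𝗍
    ∼-𝗍     : ∼ 𝗍 ≈ 𝖿
    ∼-⋁     : ∀ R T → ∼ [ R , T ] ≈ ⦅ ∼ R , ∼ T ⦆
    ∼-⋀     : ∀ R T → ∼ ⦅ R , T ⦆ ≈ [ ∼ R , ∼ T ]
    ∼-∼     : ∀ R → ∼ ∼ R ≈ R
    ∼-∃     : ∀ x R → ∼ ∃ˢ x R ≈ ∀ˢ x (∼ R)
    ∼-∀     : ∀ x R → ∼ ∀ˢ x R ≈ ∃ˢ x (∼ R)

    ∀-rename : ∀ x y R → ¬ (y ∈ˢ R) → FreeForˢ (var y) x R →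
               ∀ˢ x R ≈ ∀ˢ y (R [ x / var y ]ˢ)
    ∃-rename : ∀ x y R → ¬ (y ∈ˢ R) → FreeForˢ (var y) x R →
               ∃ˢ x R ≈ ∃ˢ y (R [ x / var y ]ˢ)
    ∀-vacuous : ∀ y R → ¬ (y ∈ˢ R) → ∀ˢ y R ≈ R
    ∃-vacuous : ∀ y R → ¬ (y ∈ˢ R) → ∃ˢ y R ≈ R

    ctx-cong : ∀ S {R T} → R ≈ T → S ⟪ R ⟫ ≈ S ⟪ T ⟫
    ∼-cong   : ∀ {R T} → R ≈ T → ∼ R ≈ ∼ T

  ----------------------------------------------------------------------
  -- The system SKSgq

  -- Instances of the inference rules; the premise is the left argument.
  data _⇝_ : Structure → Structure → Set where
    i↓ : ∀ S R → (S ⟪ 𝗍 ⟫) ⇝ (S ⟪ [ R , ∼ R ] ⟫)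
    i↑ : ∀ S R → (S ⟪ ⦅ R , ∼ R ⦆ ⟫) ⇝ (S ⟪ 𝖿 ⟫)
    s  : ∀ S R T U → (S ⟪ ⦅ [ R , U ] , T ⦆ ⟫) ⇝ (S ⟪ [ ⦅ R , T ⦆ , U ] ⟫)
    w↓ : ∀ S R → (S ⟪ 𝖿 ⟫) ⇝ (S ⟪ R ⟫)
    w↑ : ∀ S R → (S ⟪ R ⟫) ⇝ (S ⟪ 𝗍 ⟫)
    c↓ : ∀ S R → (S ⟪ [ R , R ] ⟫) ⇝ (S ⟪ R ⟫)
    c↑ : ∀ S R → (S ⟪ R ⟫) ⇝ (S ⟪ ⦅ R , R ⦆ ⟫)
    u↓ : ∀ S x R T →
         (S ⟪ ∀ˢ x [ R , T ] ⟫) ⇝ (S ⟪ [ ∀ˢ x R , ∃ˢ x T ] ⟫)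
    u↑ : ∀ S x R T →
         (S ⟪ ⦅ ∃ˢ x R , ∀ˢ x T ⦆ ⟫) ⇝ (S ⟪ ∃ˢ x ⦅ R , T ⦆ ⟫)
    n↓ : ∀ S x t R → FreeForˢ t x R →
         (S ⟪ R [ x / t ]ˢ ⟫) ⇝ (S ⟪ ∃ˢ x R ⟫)
    n↑ : ∀ S x t R → FreeForˢ t x R →
         (S ⟪ ∀ˢ x R ⟫) ⇝ (S ⟪ R [ x / t ]ˢ ⟫)

  -- SKSgq Q P: the derivations with premise Q and conclusion P.  Equivalent
  -- structures are not distinguished, hence the steps along _≈_.
  SKSgq : Structure → Structure → Set
  SKSgq = Star (_≈_ ∪ _⇝_)

  ----------------------------------------------------------------------
  -- The system GS1 + Cut

  infixr 7 _∧_
  infixr 6 _∨_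

  data Formula : Set where
    atom    : Atom → Formula
    ⊤ ⊥     : Formula
    _∧_ _∨_ : Formula → Formula → Formula
    ∃ᶠ ∀ᶠ   : Var → Formula → Formula

  dual : Formula → Formula
  dual (atom a) = atom (dualᵃ a)
  dual ⊤        = ⊥
  dual ⊥        = ⊤
  dual (A ∧ B)  = dual A ∨ dual B
  dual (A ∨ B)  = dual A ∧ dual B
  dual (∃ᶠ x A) = ∀ᶠ x (dual A)
  dual (∀ᶠ x A) = ∃ᶠ x (dual A)

  -- x ∈ᶠ A : the variable x occurs free in A.
  data _∈ᶠ_ (x : Var) : Formula → Set where
    atom : ∀ {a} → x ∈ᵃ a → x ∈ᶠ atom a
    ∧ˡ   : ∀ {A B} → x ∈ᶠ A → x ∈ᶠ (A ∧ B)
    ∧ʳ   : ∀ {A B} → x ∈ᶠ B → x ∈ᶠ (A ∧ B)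
    ∨ˡ   : ∀ {A B} → x ∈ᶠ A → x ∈ᶠ (A ∨ B)
    ∨ʳ   : ∀ {A B} → x ∈ᶠ B → x ∈ᶠ (A ∨ B)
    ∃ᶠ   : ∀ {y A} → x ≢ y → x ∈ᶠ A → x ∈ᶠ ∃ᶠ y A
    ∀ᶠ   : ∀ {y A} → x ≢ y → x ∈ᶠ A → x ∈ᶠ ∀ᶠ y A

  _[_/_]ᶠ : Formula → Var → Term → Formula
  atom a  [ x / t ]ᶠ = atom (a [ x / t ]ᵃ)
  ⊤       [ x / t ]ᶠ = ⊤
  ⊥       [ x / t ]ᶠ = ⊥
  (A ∧ B) [ x / t ]ᶠ = (A [ x / t ]ᶠ) ∧ (B [ x / t ]ᶠ)
  (A ∨ B) [ x / t ]ᶠ = (A [ x / t ]ᶠ) ∨ (B [ x / t ]ᶠ)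
  ∃ᶠ y A  [ x / t ]ᶠ = ∃ᶠ y (if does (x ≟ y) then A else A [ x / t ]ᶠ)
  ∀ᶠ y A  [ x / t ]ᶠ = ∀ᶠ y (if does (x ≟ y) then A else A [ x / t ]ᶠ)

  data FreeForᶠ (t : Term) (x : Var) : Formula → Set where
    atom : ∀ {a} → FreeForᶠ t x (atom a)
    ⊤    : FreeForᶠ t x ⊤
    ⊥    : FreeForᶠ t x ⊥
    _∧_  : ∀ {A B} → FreeForᶠ t x A → FreeForᶠ t x B → FreeForᶠ t x (A ∧ B)
    _∨_  : ∀ {A B} → FreeForᶠ t x A → FreeForᶠ t x B → FreeForᶠ t x (A ∨ B)
    ∃ᶠ-∉ : ∀ {y A} → ¬ (x ∈ᶠ ∃ᶠ y A) → FreeForᶠ t x (∃ᶠ y A)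
    ∃ᶠ   : ∀ {y A} → ¬ (y ∈ᵗ t) → FreeForᶠ t x A → FreeForᶠ t x (∃ᶠ y A)
    ∀ᶠ-∉ : ∀ {y A} → ¬ (x ∈ᶠ ∀ᶠ y A) → FreeForᶠ t x (∀ᶠ y A)
    ∀ᶠ   : ∀ {y A} → ¬ (y ∈ᵗ t) → FreeForᶠ t x A → FreeForᶠ t x (∀ᶠ y A)

  -- Finite multisets, as lists modulo permutation (see the constructor perm).
  Sequent : Set
  Sequent = List Formula

  -- GS1+Cut Δ Φ: the derivation trees with conclusion ⊢ Φ whose open leaves,
  -- from left to right and with repetitions, are Δ.
  data GS1+Cut : List Sequent → Sequent → Set where
    leaf : ∀ Φ → GS1+Cut (Φ ∷ []) Φ
    perm : ∀ {Δ Φ Ψ} → Φ ↭ Ψ → GS1+Cut Δ Φ → GS1+Cut Δ Ψ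

    R⊤   : GS1+Cut [] (⊤ ∷ [])
    Ax   : ∀ A → GS1+Cut [] (A ∷ dual A ∷ [])
    R∧   : ∀ {Δ Δ′ Φ Ψ A B} →
           GS1+Cut Δ (A ∷ Φ) → GS1+Cut Δ′ (B ∷ Ψ) →
           GS1+Cut (Δ ++ Δ′) (A ∧ B ∷ Φ ++ Ψ)
    R∨   : ∀ {Δ Φ A B} → GS1+Cut Δ (A ∷ B ∷ Φ) → GS1+Cut Δ (A ∨ B ∷ Φ)
    RC   : ∀ {Δ Φ A} → GS1+Cut Δ (A ∷ A ∷ Φ) → GS1+Cut Δ (A ∷ Φ)
    RW   : ∀ {Δ Φ} A → GS1+Cut Δ Φ → GS1+Cut Δ (A ∷ Φ)
    R∃   : ∀ {Δ Φ x A} t → FreeForᶠ t x A →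
           GS1+Cut Δ (A [ x / t ]ᶠ ∷ Φ) → GS1+Cut Δ (∃ᶠ x A ∷ Φ)
    R∀   : ∀ {Δ Φ x A} y → FreeForᶠ (var y) x A →
           All (λ B → ¬ (y ∈ᶠ B)) (∀ᶠ x A ∷ Φ) →
           GS1+Cut Δ (A [ x / var y ]ᶠ ∷ Φ) → GS1+Cut Δ (∀ᶠ x A ∷ Φ)
    Cut  : ∀ {Δ Δ′ Φ Ψ} A →
           GS1+Cut Δ (A ∷ Φ) → GS1+Cut Δ′ (dual A ∷ Ψ) →
           GS1+Cut (Δ ++ Δ′) (Φ ++ Ψ)

  ----------------------------------------------------------------------
  -- Translation

  -- The structures with negation only on atoms and only binary conjunctions
  -- and disjunctions.
  data Translatable : Structure → Set where
    𝖿     : Translatable 𝖿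
    𝗍     : Translatable 𝗍
    atom  : ∀ a → Translatable (atom a)
    ∼atom : ∀ a → Translatable (∼ atom a)
    ⋁₂    : ∀ {R T} → Translatable R → Translatable T → Translatable [ R , T ]
    ⋀₂    : ∀ {R T} → Translatable R → Translatable T → Translatable ⦅ R , T ⦆
    ∃ˢ    : ∀ x {R} → Translatable R → Translatable (∃ˢ x R)
    ∀ˢ    : ∀ x {R} → Translatable R → Translatable (∀ˢ x R)

  _ᴳ : ∀ {R} → Translatable R → Formula
  𝖿         ᴳ = ⊥
  𝗍         ᴳ = ⊤
  atom a    ᴳ = atom a
  ∼atom a   ᴳ = atom (dualᵃ a)
  ⋁₂ r t    ᴳ = (r ᴳ) ∨ (t ᴳ)
  ⋀₂ r t    ᴳ = (r ᴳ) ∧ (t ᴳ)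
  ∃ˢ x r    ᴳ = ∃ᶠ x (r ᴳ)
  ∀ˢ x r    ᴳ = ∀ᶠ x (r ᴳ)

{-# OPTIONS --safe #-}

-- A structure R of any shape is read as a formula ⟦ R ⟧, where ∼ becomes the
-- De Morgan dual; on translatable structures this is the translation ᴳ.  Every
-- inference rule and every equation becomes a provable sequent ⊢ dual A, B,
-- and these sequents compose by Cut and are preserved by contexts.  A single
-- cut of the open leaf ⊢ A against the resulting proof of ⊢ dual A, B yields
-- the derivation, so that the premise occurs as a leaf exactly once.
module Submission where

open import Defs
open import Data.Bool using (if_then_else_; true; false)
open import Data.List using (List; []; _∷_; _++_)
open import Data.List.NonEmpty using (List⁺; _∷_; _++⁺_)
open import Data.List.Properties using (++-identityʳ)
open import Data.List.Relation.Binary.Permutation.Propositional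
  using (swap; prep; ↭-refl; ↭-trans)
open import Data.List.Relation.Binary.Permutation.Propositional.Properties
  using (++-comm)
open import Data.List.Relation.Unary.All using (All; []; _∷_)
open import Data.List.Relation.Unary.Any using (Any; here; there)
open import Data.Nat using (_≟_)
open import Data.Product using (_×_; _,_; proj₁; proj₂)
open import Data.Sum using (_⊎_; inj₁; inj₂)
open import Data.Vec using (Vec; []; _∷_)
open import Function using (_∘_)
open import Relation.Binary.Construct.Closure.ReflexiveTransitive using (ε; _◅_)
open import Relation.Binary.PropositionalEquality
  using (_≡_; refl; sym; trans; cong; cong₂; subst; subst₂)
open import Relation.Nullary using (¬_; Dec; yes; no; does)

module Soundness (𝓛 : Signature) where
  open Calculi 𝓛

  -- Substitution, free variables and duality

  if-both : ∀ {A : Set} {u v w : A} b → u ≡ w → v ≡ w → (if b then u else v) ≡ w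
  if-both true  u≡w _   = u≡w
  if-both false _   v≡w = v≡w

  mutual
    substᵗ-id : ∀ x t → t [ x / var x ]ᵗ ≡ t
    substᵗ-id x (var y)    = lemma (x ≟ y)
      where
      -- The decision is an argument, so that matching on it computes the conditional and identifies
      -- the variables at once.
      lemma : (d : Dec (x ≡ y)) → (if does d then var x else var y) ≡ var y
      lemma (yes refl) = refl
      lemma (no _)     = refl
    substᵗ-id x (fun g ts) = cong (fun g) (substᵗˢ-id x ts)

    substᵗˢ-id : ∀ {n} x (ts : Vec Term n) → ts [ x / var x ]ᵗˢ ≡ ts
    substᵗˢ-id x []       = refl
    substᵗˢ-id x (t ∷ ts) = cong₂ _∷_ (substᵗ-id x t) (substᵗˢ-id x ts)

  -- Allows the bound variable itself to serve as eigenvariable or witness: `R∀` and `R∃` then act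
  -- on the bare matrix.
  substᶠ-id : ∀ x A → A [ x / var x ]ᶠ ≡ A
  substᶠ-id x (atom (pos p ts)) = cong (λ us → atom (pos p us)) (substᵗˢ-id x ts)
  substᶠ-id x (atom (neg p ts)) = cong (λ us → atom (neg p us)) (substᵗˢ-id x ts)
  substᶠ-id x ⊤        = refl
  substᶠ-id x ⊥        = refl
  substᶠ-id x (A ∧ B)  = cong₂ _∧_ (substᶠ-id x A) (substᶠ-id x B)
  substᶠ-id x (A ∨ B)  = cong₂ _∨_ (substᶠ-id x A) (substᶠ-id x B)
  substᶠ-id x (∃ᶠ y A) = cong (∃ᶠ y) (if-both (does (x ≟ y)) refl (substᶠ-id x A))
  substᶠ-id x (∀ᶠ y A) = cong (∀ᶠ y) (if-both (does (x ≟ y)) refl (substᶠ-id x A))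

  ∉-∃ : ∀ x A → ¬ (x ∈ᶠ ∃ᶠ x A)
  ∉-∃ x A (∃ᶠ x≢x _) = x≢x refl

  ∉-∀ : ∀ x A → ¬ (x ∈ᶠ ∀ᶠ x A)
  ∉-∀ x A (∀ᶠ x≢x _) = x≢x refl

  -- Below a quantifier on `x` no free `x` is left to replace; a quantifier on any other variable
  -- cannot capture `var x`.
  freeFor-id : ∀ x A → FreeForᶠ (var x) x A
  freeFor-id x (atom a) = atom
  freeFor-id x ⊤        = ⊤
  freeFor-id x ⊥        = ⊥
  freeFor-id x (A ∧ B)  = freeFor-id x A ∧ freeFor-id x B
  freeFor-id x (A ∨ B)  = freeFor-id x A ∨ freeFor-id x B
  freeFor-id x (∃ᶠ y A) with y ≟ x
  ... | yes refl = ∃ᶠ-∉ (∉-∃ x A)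
  ... | no y≢x   = ∃ᶠ (λ { here → y≢x refl }) (freeFor-id x A)
  freeFor-id x (∀ᶠ y A) with y ≟ x
  ... | yes refl = ∀ᶠ-∉ (∉-∀ x A)
  ... | no y≢x   = ∀ᶠ (λ { here → y≢x refl }) (freeFor-id x A)

  dual-involutive : ∀ A → dual (dual A) ≡ A
  dual-involutive (atom (pos p ts)) = refl
  dual-involutive (atom (neg p ts)) = refl
  dual-involutive ⊤        = refl
  dual-involutive ⊥        = refl
  dual-involutive (A ∧ B)  = cong₂ _∧_ (dual-involutive A) (dual-involutive B)
  dual-involutive (A ∨ B)  = cong₂ _∨_ (dual-involutive A) (dual-involutive B)
  dual-involutive (∃ᶠ x A) = cong (∃ᶠ x) (dual-involutive A)
  dual-involutive (∀ᶠ x A) = cong (∀ᶠ x) (dual-involutive A)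

  dual-subst : ∀ x t A → dual (A [ x / t ]ᶠ) ≡ dual A [ x / t ]ᶠ
  dual-subst-if : ∀ b x t A →
    dual (if b then A else A [ x / t ]ᶠ) ≡ (if b then dual A else dual A [ x / t ]ᶠ)

  dual-subst x t (atom (pos p ts)) = refl
  dual-subst x t (atom (neg p ts)) = refl
  dual-subst x t ⊤        = refl
  dual-subst x t ⊥        = refl
  dual-subst x t (A ∧ B)  = cong₂ _∨_ (dual-subst x t A) (dual-subst x t B)
  dual-subst x t (A ∨ B)  = cong₂ _∧_ (dual-subst x t A) (dual-subst x t B)
  dual-subst x t (∃ᶠ y A) = cong (∀ᶠ y) (dual-subst-if (does (x ≟ y)) x t A)
  dual-subst x t (∀ᶠ y A) = cong (∃ᶠ y) (dual-subst-if (does (x ≟ y)) x t A)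

  dual-subst-if true  x t A = refl
  dual-subst-if false x t A = dual-subst x t A

  ∈-dual⁻ : ∀ {x} A → x ∈ᶠ dual A → x ∈ᶠ A
  ∈-dual⁻ (atom (pos p ts)) (atom (neg x∈)) = atom (pos x∈)
  ∈-dual⁻ (atom (neg p ts)) (atom (pos x∈)) = atom (neg x∈)
  ∈-dual⁻ (A ∧ B)  (∨ˡ x∈)     = ∧ˡ (∈-dual⁻ A x∈)
  ∈-dual⁻ (A ∧ B)  (∨ʳ x∈)     = ∧ʳ (∈-dual⁻ B x∈)
  ∈-dual⁻ (A ∨ B)  (∧ˡ x∈)     = ∨ˡ (∈-dual⁻ A x∈)
  ∈-dual⁻ (A ∨ B)  (∧ʳ x∈)     = ∨ʳ (∈-dual⁻ B x∈)
  ∈-dual⁻ (∃ᶠ y A) (∀ᶠ x≢y x∈) = ∃ᶠ x≢y (∈-dual⁻ A x∈)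
  ∈-dual⁻ (∀ᶠ y A) (∃ᶠ x≢y x∈) = ∀ᶠ x≢y (∈-dual⁻ A x∈)

  freeFor-dual : ∀ {t x A} → FreeForᶠ t x A → FreeForᶠ t x (dual A)
  freeFor-dual {A = atom (pos p ts)} atom = atom
  freeFor-dual {A = atom (neg p ts)} atom = atom
  freeFor-dual ⊤         = ⊥
  freeFor-dual ⊥         = ⊤
  freeFor-dual (a ∧ b)   = freeFor-dual a ∨ freeFor-dual b
  freeFor-dual (a ∨ b)   = freeFor-dual a ∧ freeFor-dual b
  freeFor-dual {A = A} (∃ᶠ-∉ x∉) = ∀ᶠ-∉ (x∉ ∘ ∈-dual⁻ A)
  freeFor-dual (∃ᶠ y∉ a) = ∀ᶠ y∉ (freeFor-dual a)
  freeFor-dual {A = A} (∀ᶠ-∉ x∉) = ∃ᶠ-∉ (x∉ ∘ ∈-dual⁻ A)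
  freeFor-dual (∀ᶠ y∉ a) = ∃ᶠ y∉ (freeFor-dual a)

  -- Entailment in GS1+Cut

  infix 4 _⊢_ _⊣⊢_

  -- Implication as a two-formula sequent. The empty list of leaves makes it a closed proof, so cuts
  -- between entailments create no open leaves.
  _⊢_ : Formula → Formula → Set
  A ⊢ B = GS1+Cut [] (dual A ∷ B ∷ [])

  _⊣⊢_ : Formula → Formula → Set
  A ⊣⊢ B = (A ⊢ B) × (B ⊢ A)

  exch : ∀ {Δ A B Φ} → GS1+Cut Δ (A ∷ B ∷ Φ) → GS1+Cut Δ (B ∷ A ∷ Φ)
  exch = perm (swap _ _ ↭-refl)

  rotate : ∀ {Δ A B C Φ} → GS1+Cut Δ (A ∷ B ∷ C ∷ Φ) → GS1+Cut Δ (B ∷ C ∷ A ∷ Φ)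
  rotate = perm (↭-trans (swap _ _ ↭-refl) (prep _ (swap _ _ ↭-refl)))

  ⊢-refl : ∀ {A} → A ⊢ A
  ⊢-refl = exch (Ax _)

  ⊢-reflexive : ∀ {A B} → A ≡ B → A ⊢ B
  ⊢-reflexive refl = ⊢-refl

  ⊢-trans : ∀ {A B C} → A ⊢ B → B ⊢ C → A ⊢ C
  ⊢-trans f g = Cut _ (exch f) g

  ⊣⊢-reflexive : ∀ {A B} → A ≡ B → A ⊣⊢ B
  ⊣⊢-reflexive A≡B = ⊢-reflexive A≡B , ⊢-reflexive (sym A≡B)

  ⊣⊢-sym : ∀ {A B} → A ⊣⊢ B → B ⊣⊢ A
  ⊣⊢-sym (f , g) = g , f

  ⊣⊢-trans : ∀ {A B C} → A ⊣⊢ B → B ⊣⊢ C → A ⊣⊢ C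
  ⊣⊢-trans (f , g) (f′ , g′) = ⊢-trans f f′ , ⊢-trans g′ g

  dual-anti : ∀ {A B} → A ⊢ B → dual B ⊢ dual A
  dual-anti {A} {B} f =
    subst (λ C → GS1+Cut [] (C ∷ dual A ∷ [])) (sym (dual-involutive B)) (exch f)

  -- The source of the duality arguments: since `dual` computes on connectives, laws of `∧` and `∃ᶠ`
  -- follow from those of `∨` and `∀ᶠ` at dual formulas.
  dual-anti⁻ : ∀ {A B} → dual B ⊢ dual A → A ⊢ B
  dual-anti⁻ {A} {B} f =
    exch (subst (λ C → GS1+Cut [] (C ∷ dual A ∷ [])) (dual-involutive B) f)

  dual-cong : ∀ {A B} → A ⊣⊢ B → dual A ⊣⊢ dual B
  dual-cong (f , g) = dual-anti g , dual-anti f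

  dual-cong⁻ : ∀ {A B} → dual A ⊣⊢ dual B → A ⊣⊢ B
  dual-cong⁻ (f , g) = dual-anti⁻ g , dual-anti⁻ f

  -- Propositional laws

  ⊢⊤ : ∀ {A} → A ⊢ ⊤
  ⊢⊤ = RW _ R⊤

  ⊥⊢ : ∀ {A} → ⊥ ⊢ A
  ⊥⊢ = dual-anti⁻ ⊢⊤

  -- `R∧` joins the contexts of its premises, which leaves two copies of `C`; `RC` merges them.
  ∨-elim : ∀ {A B C} → A ⊢ C → B ⊢ C → A ∨ B ⊢ C
  ∨-elim f g = exch (RC (rotate (R∧ f g)))

  ∨-introˡ : ∀ {A B} → A ⊢ A ∨ B
  ∨-introˡ = exch (R∨ (exch (RW _ (Ax _))))

  ∨-introʳ : ∀ {A B} → B ⊢ A ∨ B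
  ∨-introʳ = exch (R∨ (RW _ (Ax _)))

  ∨-mono : ∀ {A A′ B B′} → A ⊢ A′ → B ⊢ B′ → A ∨ B ⊢ A′ ∨ B′
  ∨-mono f g = ∨-elim (⊢-trans f ∨-introˡ) (⊢-trans g ∨-introʳ)

  ∧-mono : ∀ {A A′ B B′} → A ⊢ A′ → B ⊢ B′ → A ∧ B ⊢ A′ ∧ B′
  ∧-mono f g = dual-anti⁻ (∨-mono (dual-anti f) (dual-anti g))

  ∨-comm : ∀ A B → A ∨ B ⊢ B ∨ A
  ∨-comm A B = ∨-elim ∨-introʳ ∨-introˡ

  ∧-comm : ∀ A B → A ∧ B ⊢ B ∧ A
  ∧-comm A B = dual-anti⁻ (∨-comm (dual B) (dual A))

  ∨-assoc : ∀ A B C → (A ∨ B) ∨ C ⊣⊢ A ∨ (B ∨ C)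
  ∨-assoc A B C =
      ∨-elim (∨-elim ∨-introˡ (⊢-trans ∨-introˡ ∨-introʳ)) (⊢-trans ∨-introʳ ∨-introʳ)
    , ∨-elim (⊢-trans ∨-introˡ ∨-introˡ) (∨-elim (⊢-trans ∨-introʳ ∨-introˡ) ∨-introʳ)

  ∧-assoc : ∀ A B C → (A ∧ B) ∧ C ⊣⊢ A ∧ (B ∧ C)
  ∧-assoc A B C = dual-cong⁻ (∨-assoc (dual A) (dual B) (dual C))

  ∨-idem : ∀ A → A ∨ A ⊣⊢ A
  ∨-idem A = ∨-elim ⊢-refl ⊢-refl , ∨-introˡ

  ∧-idem : ∀ A → A ∧ A ⊣⊢ A
  ∧-idem A = dual-cong⁻ (∨-idem (dual A))

  ∨-identityˡ : ∀ A → ⊥ ∨ A ⊣⊢ A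
  ∨-identityˡ A = ∨-elim ⊥⊢ ⊢-refl , ∨-introʳ

  ∧-identityˡ : ∀ A → ⊤ ∧ A ⊣⊢ A
  ∧-identityˡ A = dual-cong⁻ (∨-identityˡ (dual A))

  excluded-middle : ∀ A → ⊤ ⊢ A ∨ dual A
  excluded-middle A = RW _ (R∨ (Ax A))

  contradiction⊢ : ∀ A → A ∧ dual A ⊢ ⊥
  contradiction⊢ A = dual-anti⁻ (excluded-middle (dual A))

  switch : ∀ A B C → (A ∨ C) ∧ B ⊢ (A ∧ B) ∨ C
  -- The inner `R∧` gives `dual A`, `dual B`, `A ∧ B`. The outer one joins `dual A` with `dual C`
  -- and adds `C` to the context; `++-comm` then swaps the two halves so that both disjunctions can
  -- be formed.
  switch A B C = R∨ (rotate (R∨ (perm (++-comm (_ ∷ _ ∷ []) (_ ∷ _ ∷ []))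
    (R∧ (rotate (R∧ (Ax A) (Ax B))) (⊢-refl {C})))))

  -- Quantifiers

  -- The dual of the hypothesis is existential, so this is `R∃` with witness `t` on an identity
  -- sequent.
  ∀-elim : ∀ {x t A} → FreeForᶠ t x A → ∀ᶠ x A ⊢ A [ x / t ]ᶠ
  ∀-elim {x} {t} {A} ff = R∃ t (freeFor-dual ff)
    (subst (λ B → GS1+Cut [] (B ∷ A [ x / t ]ᶠ ∷ [])) (dual-subst x t A) ⊢-refl)

  ∀-elim-id : ∀ x A → ∀ᶠ x A ⊢ A
  ∀-elim-id x A = subst (∀ᶠ x A ⊢_) (substᶠ-id x A) (∀-elim (freeFor-id x A))

  ∀-intro : ∀ {x y A B} → FreeForᶠ (var y) x B → ¬ (y ∈ᶠ A) → ¬ (y ∈ᶠ ∀ᶠ x B) →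
            A ⊢ B [ x / var y ]ᶠ → A ⊢ ∀ᶠ x B
  ∀-intro {y = y} {A} ff y∉A y∉∀ f =
    exch (R∀ y ff (y∉∀ ∷ (y∉A ∘ ∈-dual⁻ A) ∷ []) (exch f))

  ∀-intro-id : ∀ {x A B} → ¬ (x ∈ᶠ A) → A ⊢ B → A ⊢ ∀ᶠ x B
  ∀-intro-id {x} {A} {B} x∉A f =
    ∀-intro (freeFor-id x B) x∉A (∉-∀ x B) (subst (A ⊢_) (sym (substᶠ-id x B)) f)

  ∀-mono : ∀ {x A B} → A ⊢ B → ∀ᶠ x A ⊢ ∀ᶠ x B
  ∀-mono {x} {A} f = ∀-intro-id (∉-∀ x A) (⊢-trans (∀-elim-id x A) f)

  ∀-renameᶠ : ∀ {x y A} → ¬ (y ∈ᶠ A) → FreeForᶠ (var y) x A →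
              ∀ᶠ x A ⊣⊢ ∀ᶠ y (A [ x / var y ]ᶠ)
  ∀-renameᶠ {x} {y} {A} y∉A ff =
      ∀-intro-id y∉∀ (∀-elim ff)
    -- With eigenvariable `y` the goal is already `A [ x / var y ]ᶠ`, so the renaming never has to
    -- be undone.
    , ∀-intro ff (∉-∀ y _) y∉∀ (∀-elim-id y _)
    where
    y∉∀ : ¬ (y ∈ᶠ ∀ᶠ x A)
    y∉∀ (∀ᶠ _ y∈A) = y∉A y∈A

  ∀-vacuousᶠ : ∀ {x A} → ¬ (x ∈ᶠ A) → ∀ᶠ x A ⊣⊢ A
  ∀-vacuousᶠ x∉A = ∀-elim-id _ _ , ∀-intro-id x∉A ⊢-refl

  ∃-intro : ∀ {x t A} → FreeForᶠ t x A → A [ x / t ]ᶠ ⊢ ∃ᶠ x A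
  ∃-intro ff = exch (R∃ _ ff (Ax _))

  ∃-mono : ∀ {x A B} → A ⊢ B → ∃ᶠ x A ⊢ ∃ᶠ x B
  ∃-mono f = dual-anti⁻ (∀-mono (dual-anti f))

  ∃-renameᶠ : ∀ {x y A} → ¬ (y ∈ᶠ A) → FreeForᶠ (var y) x A →
              ∃ᶠ x A ⊣⊢ ∃ᶠ y (A [ x / var y ]ᶠ)
  ∃-renameᶠ {x} {y} {A} y∉A ff = dual-cong⁻
    (subst (λ B → ∀ᶠ x (dual A) ⊣⊢ ∀ᶠ y B) (sym (dual-subst x (var y) A))
      (∀-renameᶠ (y∉A ∘ ∈-dual⁻ A) (freeFor-dual ff)))

  ∃-vacuousᶠ : ∀ {x A} → ¬ (x ∈ᶠ A) → ∃ᶠ x A ⊣⊢ A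
  ∃-vacuousᶠ {A = A} x∉A = dual-cong⁻ (∀-vacuousᶠ (x∉A ∘ ∈-dual⁻ A))

  -- Read upwards: `R∀` comes first, while `x` is still bound in every formula of the sequent and so
  -- is a legal eigenvariable; then both existentials are instantiated with the same `x`, and `R∧`
  -- splits into two identities.
  ∀-∨-∃ : ∀ x A B → ∀ᶠ x (A ∨ B) ⊢ ∀ᶠ x A ∨ ∃ᶠ x B
  ∀-∨-∃ x A B = exch (R∨ (R∀ x (freeFor-id x A)
      (∉-∀ x A ∷ ∉-∃ x B ∷ ∉-∃ x (dual (A ∨ B)) ∷ [])
      (subst (λ C → GS1+Cut [] (C ∷ ∃ᶠ x B ∷ ∃ᶠ x (dual (A ∨ B)) ∷ []))
        (sym (substᶠ-id x A))
        (rotate (rotate (∃R (rotate (rotate (∃R (R∧ (⊢-refl {A}) (⊢-refl {B})))))))))))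
    where
    ∃R : ∀ {Δ Φ C} → GS1+Cut Δ (C ∷ Φ) → GS1+Cut Δ (∃ᶠ x C ∷ Φ)
    ∃R {Δ} {Φ} {C} d = R∃ (var x) (freeFor-id x C)
      (subst (λ D → GS1+Cut Δ (D ∷ Φ)) (sym (substᶠ-id x C)) d)

  ∃-∧-∀ : ∀ x A B → ∃ᶠ x A ∧ ∀ᶠ x B ⊢ ∃ᶠ x (A ∧ B)
  ∃-∧-∀ x A B = dual-anti⁻ (∀-∨-∃ x (dual A) (dual B))

  -- Interpretation of arbitrary structures

  mutual
    ⟦_⟧ : Structure → Formula
    ⟦ 𝖿 ⟧          = ⊥
    ⟦ 𝗍 ⟧          = ⊤
    ⟦ atom a ⟧     = atom a
    ⟦ ⋁ (R ∷ Rs) ⟧ = fold _∨_ R Rs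
    ⟦ ⋀ (R ∷ Rs) ⟧ = fold _∧_ R Rs
    ⟦ ∼ R ⟧        = dual ⟦ R ⟧
    ⟦ ∃ˢ x R ⟧     = ∃ᶠ x ⟦ R ⟧
    ⟦ ∀ˢ x R ⟧     = ∀ᶠ x ⟦ R ⟧

    -- Nests to the right without a final unit, so a two-element list yields exactly the binary
    -- connective and `ᴳ≡⟦⟧` is a plain equality.
    fold : (Formula → Formula → Formula) → Structure → List Structure → Formula
    fold _•_ R []       = ⟦ R ⟧
    fold _•_ R (T ∷ Ts) = ⟦ R ⟧ • fold _•_ T Ts

  ᴳ≡⟦⟧ : ∀ {R} (r : Translatable R) → r ᴳ ≡ ⟦ R ⟧
  ᴳ≡⟦⟧ 𝖿         = refl
  ᴳ≡⟦⟧ 𝗍         = refl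
  ᴳ≡⟦⟧ (atom a)  = refl
  ᴳ≡⟦⟧ (∼atom a) = refl
  ᴳ≡⟦⟧ (⋁₂ r t)  = cong₂ _∨_ (ᴳ≡⟦⟧ r) (ᴳ≡⟦⟧ t)
  ᴳ≡⟦⟧ (⋀₂ r t)  = cong₂ _∧_ (ᴳ≡⟦⟧ r) (ᴳ≡⟦⟧ t)
  ᴳ≡⟦⟧ (∃ˢ x r)  = cong (∃ᶠ x) (ᴳ≡⟦⟧ r)
  ᴳ≡⟦⟧ (∀ˢ x r)  = cong (∀ᶠ x) (ᴳ≡⟦⟧ r)

  mutual
    ⟦⟧-subst : ∀ x t R → ⟦ R [ x / t ]ˢ ⟧ ≡ ⟦ R ⟧ [ x / t ]ᶠ
    ⟦⟧-subst x t 𝖿            = refl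
    ⟦⟧-subst x t 𝗍            = refl
    ⟦⟧-subst x t (atom a)     = refl
    ⟦⟧-subst x t (⋁ (R ∷ Rs)) = fold-subst _∨_ x t (λ _ _ → refl) R Rs
    ⟦⟧-subst x t (⋀ (R ∷ Rs)) = fold-subst _∧_ x t (λ _ _ → refl) R Rs
    ⟦⟧-subst x t (∼ R)        =
      trans (cong dual (⟦⟧-subst x t R)) (dual-subst x t ⟦ R ⟧)
    ⟦⟧-subst x t (∃ˢ y R)     = cong (∃ᶠ y) (⟦⟧-subst-if (does (x ≟ y)) x t R)
    ⟦⟧-subst x t (∀ˢ y R)     = cong (∀ᶠ y) (⟦⟧-subst-if (does (x ≟ y)) x t R)

    ⟦⟧-subst-if : ∀ b x t R →
      ⟦ if b then R else R [ x / t ]ˢ ⟧ ≡ (if b then ⟦ R ⟧ else ⟦ R ⟧ [ x / t ]ᶠ)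
    ⟦⟧-subst-if true  x t R = refl
    ⟦⟧-subst-if false x t R = ⟦⟧-subst x t R

    fold-subst : ∀ _•_ x t →
      (∀ A B → (A • B) [ x / t ]ᶠ ≡ (A [ x / t ]ᶠ) • (B [ x / t ]ᶠ)) →
      ∀ R Rs → fold _•_ (R [ x / t ]ˢ) (Rs [ x / t ]ˢˢ) ≡ fold _•_ R Rs [ x / t ]ᶠ
    fold-subst _•_ x t hom R []       = ⟦⟧-subst x t R
    fold-subst _•_ x t hom R (T ∷ Ts) =
      trans (cong₂ _•_ (⟦⟧-subst x t R) (fold-subst _•_ x t hom T Ts))
            (sym (hom _ _))

  mutual
    -- Side conditions forbid free occurrences, so they pass from structures to formulas by
    -- composition with this map.
    ∈-⟦⟧⁻ : ∀ {x} R → x ∈ᶠ ⟦ R ⟧ → x ∈ˢ R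
    ∈-⟦⟧⁻ (atom a)     (atom x∈)   = atom x∈
    ∈-⟦⟧⁻ (⋁ (R ∷ Rs)) x∈          =
      ⋁ (∈-fold⁻ _∨_ (λ { (∨ˡ x∈) → inj₁ x∈ ; (∨ʳ x∈) → inj₂ x∈ }) R Rs x∈)
    ∈-⟦⟧⁻ (⋀ (R ∷ Rs)) x∈          =
      ⋀ (∈-fold⁻ _∧_ (λ { (∧ˡ x∈) → inj₁ x∈ ; (∧ʳ x∈) → inj₂ x∈ }) R Rs x∈)
    ∈-⟦⟧⁻ (∼ R)        x∈          = ∼ ∈-⟦⟧⁻ R (∈-dual⁻ ⟦ R ⟧ x∈)
    ∈-⟦⟧⁻ (∃ˢ y R)     (∃ᶠ x≢y x∈) = ∃ˢ x≢y (∈-⟦⟧⁻ R x∈)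
    ∈-⟦⟧⁻ (∀ˢ y R)     (∀ᶠ x≢y x∈) = ∀ˢ x≢y (∈-⟦⟧⁻ R x∈)

    ∈-fold⁻ : ∀ {x} _•_ → (∀ {A B} → x ∈ᶠ (A • B) → x ∈ᶠ A ⊎ x ∈ᶠ B) →
              ∀ R Rs → x ∈ᶠ fold _•_ R Rs → Any (x ∈ˢ_) (R ∷ Rs)
    ∈-fold⁻ _•_ inv R []       x∈ = here (∈-⟦⟧⁻ R x∈)
    ∈-fold⁻ _•_ inv R (T ∷ Ts) x∈ with inv x∈
    ... | inj₁ x∈R = here (∈-⟦⟧⁻ R x∈R)
    ... | inj₂ x∈T = there (∈-fold⁻ _•_ inv T Ts x∈T)

  mutual
    freeFor-⟦⟧ : ∀ {t x R} → FreeForˢ t x R → FreeForᶠ t x ⟦ R ⟧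
    freeFor-⟦⟧ 𝖿         = ⊥
    freeFor-⟦⟧ 𝗍         = ⊤
    freeFor-⟦⟧ atom      = atom
    freeFor-⟦⟧ (⋁ ffs)   = freeFor-fold _∨_ _∨_ ffs
    freeFor-⟦⟧ (⋀ ffs)   = freeFor-fold _∧_ _∧_ ffs
    freeFor-⟦⟧ (∼ ff)    = freeFor-dual (freeFor-⟦⟧ ff)
    freeFor-⟦⟧ (∃ˢ-∉ x∉) = ∃ᶠ-∉ (x∉ ∘ ∈-⟦⟧⁻ (∃ˢ _ _))
    freeFor-⟦⟧ (∃ˢ y∉ ff) = ∃ᶠ y∉ (freeFor-⟦⟧ ff)
    freeFor-⟦⟧ (∀ˢ-∉ x∉) = ∀ᶠ-∉ (x∉ ∘ ∈-⟦⟧⁻ (∀ˢ _ _))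
    freeFor-⟦⟧ (∀ˢ y∉ ff) = ∀ᶠ y∉ (freeFor-⟦⟧ ff)

    freeFor-fold : ∀ {t x} _•_ →
      (∀ {A B} → FreeForᶠ t x A → FreeForᶠ t x B → FreeForᶠ t x (A • B)) →
      ∀ {R Rs} → All (FreeForˢ t x) (R ∷ Rs) → FreeForᶠ t x (fold _•_ R Rs)
    freeFor-fold _•_ pres (ff ∷ [])        = freeFor-⟦⟧ ff
    freeFor-fold _•_ pres (ff ∷ ff′ ∷ ffs) =
      pres (freeFor-⟦⟧ ff) (freeFor-fold _•_ pres (ff′ ∷ ffs))

  -- Folds of a monotone, associative connective over lists

  module Fold
    (_•_   : Formula → Formula → Formula)
    (mono  : ∀ {A A′ B B′} → A ⊢ A′ → B ⊢ B′ → (A • B) ⊢ (A′ • B′))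
    (assoc : ∀ A B C → ((A • B) • C) ⊣⊢ (A • (B • C)))
    where

    cong-•ˡ : ∀ {A A′ B} → A ⊣⊢ A′ → (A • B) ⊣⊢ (A′ • B)
    cong-•ˡ (f , g) = mono f ⊢-refl , mono g ⊢-refl

    cong-•ʳ : ∀ {A B B′} → B ⊣⊢ B′ → (A • B) ⊣⊢ (A • B′)
    cong-•ʳ (f , g) = mono ⊢-refl f , mono ⊢-refl g

    fold⁺ : List⁺ Structure → Formula
    fold⁺ (R ∷ Rs) = fold _•_ R Rs

    fold-mono-head : ∀ {R T} Us → ⟦ R ⟧ ⊢ ⟦ T ⟧ → fold _•_ R Us ⊢ fold _•_ T Us
    fold-mono-head []       f = f
    fold-mono-head (U ∷ Us) f = mono f ⊢-refl

    fold-mono : ∀ Ts {R R′} Us → ⟦ R ⟧ ⊢ ⟦ R′ ⟧ →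
                fold⁺ (Ts ++⁺ (R ∷ Us)) ⊢ fold⁺ (Ts ++⁺ (R′ ∷ Us))
    fold-mono []       Us f = fold-mono-head Us f
    fold-mono (T ∷ Ts) Us f = mono ⊢-refl (fold-mono Ts Us f)

    fold-++ : ∀ T Ts U Us →
              (fold _•_ T Ts • fold _•_ U Us) ⊣⊢ fold _•_ T (Ts ++ U ∷ Us)
    fold-++ T []        U Us = ⊢-refl , ⊢-refl
    fold-++ T (T′ ∷ Ts) U Us =
      ⊣⊢-trans (assoc _ _ _) (cong-•ʳ (fold-++ T′ Ts U Us))

    -- The equation stands for `R` being the list `T ∷ Ts` under the connective, which is abstract
    -- here; for `⋁` and `⋀` it holds by `refl`.
    fold-flatten-head : ∀ {R} T Ts Us → ⟦ R ⟧ ≡ fold _•_ T Ts →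
                        fold _•_ R Us ⊣⊢ fold _•_ T (Ts ++ Us)
    -- A nested list in last position is not combined with anything after it, so no associativity is
    -- involved.
    fold-flatten-head T Ts [] R≡ =
      ⊣⊢-reflexive (trans R≡ (cong (fold _•_ T) (sym (++-identityʳ Ts))))
    fold-flatten-head T Ts (U ∷ Us) R≡ =
      ⊣⊢-trans (cong-•ˡ (⊣⊢-reflexive R≡)) (fold-++ T Ts U Us)

    fold-flatten : ∀ {R} Rs T Ts Us → ⟦ R ⟧ ≡ fold _•_ T Ts →
                   fold⁺ (Rs ++⁺ (R ∷ Us)) ⊣⊢ fold⁺ (Rs ++⁺ (T ∷ (Ts ++ Us)))
    fold-flatten []       T Ts Us R≡ = fold-flatten-head T Ts Us R≡
    fold-flatten (_ ∷ Rs) T Ts Us R≡ = cong-•ʳ (fold-flatten Rs T Ts Us R≡)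

  module ⋁-fold = Fold _∨_ ∨-mono ∨-assoc
  module ⋀-fold = Fold _∧_ ∧-mono ∧-assoc

  -- Soundness of the equations and of the rules

  -- A hole never lies under a negation, so every layer of a context is monotone and one direction
  -- of entailment suffices.
  ctx-mono : ∀ S {R T} → ⟦ R ⟧ ⊢ ⟦ T ⟧ → ⟦ S ⟪ R ⟫ ⟧ ⊢ ⟦ S ⟪ T ⟫ ⟧
  ctx-mono ∙           f = f
  ctx-mono (⋁ Ts S Us) f = ⋁-fold.fold-mono Ts Us (ctx-mono S f)
  ctx-mono (⋀ Ts S Us) f = ⋀-fold.fold-mono Ts Us (ctx-mono S f)
  ctx-mono (∃ˢ x S)    f = ∃-mono (ctx-mono S f)
  ctx-mono (∀ˢ x S)    f = ∀-mono (ctx-mono S f)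

  -- Both directions are carried along because of `≈-sym`, and because `∼-cong` reverses entailment.
  ≈-sound : ∀ {R T} → R ≈ T → ⟦ R ⟧ ⊣⊢ ⟦ T ⟧
  ≈-sound ≈-refl          = ⊣⊢-reflexive refl
  ≈-sound (≈-sym e)       = ⊣⊢-sym (≈-sound e)
  ≈-sound (≈-trans e e′)  = ⊣⊢-trans (≈-sound e) (≈-sound e′)
  ≈-sound (⋁-assoc Rs (T ∷ Ts) Us) = ⋁-fold.fold-flatten Rs T Ts Us refl
  ≈-sound (⋀-assoc Rs (T ∷ Ts) Us) = ⋀-fold.fold-flatten Rs T Ts Us refl
  ≈-sound (⋁-comm R T)    = ∨-comm ⟦ R ⟧ ⟦ T ⟧ , ∨-comm ⟦ T ⟧ ⟦ R ⟧
  ≈-sound (⋀-comm R T)    = ∧-comm ⟦ R ⟧ ⟦ T ⟧ , ∧-comm ⟦ T ⟧ ⟦ R ⟧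
  ≈-sound ⋀-𝖿             = ∧-idem ⊥
  ≈-sound (⋁-unit R)      = ∨-identityˡ ⟦ R ⟧
  ≈-sound ⋁-𝗍             = ∨-idem ⊤
  ≈-sound (⋀-unit R)      = ∧-identityˡ ⟦ R ⟧
  -- `dual` already pushes negation inwards, so both sides of these De Morgan equations denote the
  -- same formula; `∼-∼` alone takes an induction.
  ≈-sound (∼-atom a)      = ⊣⊢-reflexive refl
  ≈-sound ∼-𝖿             = ⊣⊢-reflexive refl
  ≈-sound ∼-𝗍             = ⊣⊢-reflexive refl
  ≈-sound (∼-⋁ R T)       = ⊣⊢-reflexive refl
  ≈-sound (∼-⋀ R T)       = ⊣⊢-reflexive refl
  ≈-sound (∼-∼ R)         = ⊣⊢-reflexive (dual-involutive ⟦ R ⟧)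
  ≈-sound (∼-∃ x R)       = ⊣⊢-reflexive refl
  ≈-sound (∼-∀ x R)       = ⊣⊢-reflexive refl
  ≈-sound (∀-rename x y R y∉ ff) =
    subst (λ A → ∀ᶠ x ⟦ R ⟧ ⊣⊢ ∀ᶠ y A) (sym (⟦⟧-subst x (var y) R))
      (∀-renameᶠ (y∉ ∘ ∈-⟦⟧⁻ R) (freeFor-⟦⟧ ff))
  ≈-sound (∃-rename x y R y∉ ff) =
    subst (λ A → ∃ᶠ x ⟦ R ⟧ ⊣⊢ ∃ᶠ y A) (sym (⟦⟧-subst x (var y) R))
      (∃-renameᶠ (y∉ ∘ ∈-⟦⟧⁻ R) (freeFor-⟦⟧ ff))
  ≈-sound (∀-vacuous y R y∉) = ∀-vacuousᶠ (y∉ ∘ ∈-⟦⟧⁻ R)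
  ≈-sound (∃-vacuous y R y∉) = ∃-vacuousᶠ (y∉ ∘ ∈-⟦⟧⁻ R)
  ≈-sound (ctx-cong S e)  =
    ctx-mono S (proj₁ (≈-sound e)) , ctx-mono S (proj₂ (≈-sound e))
  ≈-sound (∼-cong e)      = dual-cong (≈-sound e)

  -- `ctx-mono` removes the context, reducing each deep rule to an entailment between the two
  -- fillings of the hole.
  ⇝-sound : ∀ {Q P} → Q ⇝ P → ⟦ Q ⟧ ⊢ ⟦ P ⟧
  ⇝-sound (i↓ S R)     = ctx-mono S (excluded-middle ⟦ R ⟧)
  ⇝-sound (i↑ S R)     = ctx-mono S (contradiction⊢ ⟦ R ⟧)
  ⇝-sound (s S R T U)  = ctx-mono S (switch ⟦ R ⟧ ⟦ T ⟧ ⟦ U ⟧)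
  ⇝-sound (w↓ S R)     = ctx-mono S ⊥⊢
  ⇝-sound (w↑ S R)     = ctx-mono S ⊢⊤
  ⇝-sound (c↓ S R)     = ctx-mono S (proj₁ (∨-idem ⟦ R ⟧))
  ⇝-sound (c↑ S R)     = ctx-mono S (proj₂ (∧-idem ⟦ R ⟧))
  ⇝-sound (u↓ S x R T) = ctx-mono S (∀-∨-∃ x ⟦ R ⟧ ⟦ T ⟧)
  ⇝-sound (u↑ S x R T) = ctx-mono S (∃-∧-∀ x ⟦ R ⟧ ⟦ T ⟧)
  ⇝-sound (n↓ S x t R ff) = ctx-mono S
    (subst (_⊢ ∃ᶠ x ⟦ R ⟧) (sym (⟦⟧-subst x t R)) (∃-intro (freeFor-⟦⟧ ff)))
  ⇝-sound (n↑ S x t R ff) = ctx-mono S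
    (subst (∀ᶠ x ⟦ R ⟧ ⊢_) (sym (⟦⟧-subst x t R)) (∀-elim (freeFor-⟦⟧ ff)))

  SKSgq-sound : ∀ {Q P} → SKSgq Q P → ⟦ Q ⟧ ⊢ ⟦ P ⟧
  SKSgq-sound ε            = ⊢-refl
  SKSgq-sound (inj₁ e ◅ d) = ⊢-trans (proj₁ (≈-sound e)) (SKSgq-sound d)
  SKSgq-sound (inj₂ r ◅ d) = ⊢-trans (⇝-sound r) (SKSgq-sound d)

theorem4p8 : (𝓛 : Signature) → let open Calculi 𝓛 in
    {Q P : Structure} (q : Translatable Q) (p : Translatable P) →
    SKSgq Q P →
    GS1+Cut (((q ᴳ) ∷ []) ∷ []) ((p ᴳ) ∷ [])
theorem4p8 𝓛 q p d =
  -- The leaf has no side formulas and the other premise no leaves, so both concatenations in `Cut`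
  -- compute to the required lists.
  Cut (q ᴳ) (leaf _) (subst₂ _⊢_ (sym (ᴳ≡⟦⟧ q)) (sym (ᴳ≡⟦⟧ p)) (SKSgq-sound d))
  where
  open Calculi 𝓛
  open Soundness 𝓛
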